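{- For every integer $n\geq 3$, writing $f_q(n)$ for the total number of occurrences of the pattern $q$ in all permutations of $S_n(132,213,231)$, we have $$f_{123}(n)=f_{312}(n)=\binom{n+1}{4},\qquad f_{321}(n)=\frac{n(n-2)(n-1)^2}{12}.$$
   Context: $S_n$ is the set of permutations of $\{1,\dots,n\}$ written in one-line notation $\sigma=\sigma_1\sigma_2\cdots\sigma_n$. For $q\in S_k$, an occurrence of the pattern $q$ in $\sigma\in S_n$ is a choice of indices $i_1<i_2<\cdots<i_k$ in $\{1,\dots,n\}$ such that for all $1\le j,l\le k$, $q_j<q_l$ if and only if $\sigma_{i_j}<\sigma_{i_l}$. Let $f_q(\sigma)$ be the number of occurrences of $q$ in $\sigma$; $\sigma$ avoids $q$ if $f_q(\sigma)=0$. $S_n(132,213,231)$ is the set of permutations in $S_n$ avoiding all of $132$, $213$ and $231$, and $f_q(n)=\sum_{\sigma\in S_n(132,213,231)}f_q(\sigma)$. -}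

module Defs where

open import Data.Fin.Base using (Fin; _<_)
open import Data.Fin.Patterns using (0F; 1F; 2F)
open import Data.Fin.Properties using (_≟_; _<?_; all?)
open import Data.List.Base as List using (List; []; _∷_; allFin; cartesianProductWith; filter; length)
open import Data.Nat.Base using (ℕ; zero; suc)
open import Data.Nat.ListAction using (sum)
import Data.Nat.Properties as ℕ
open import Data.Product.Base using (_×_; uncurry; <_,_>)
open import Data.Vec.Base using (Vec; []; _∷_; lookup)
open import Data.Vec.Relation.Unary.AllPairs using (allPairs?)
open import Data.Vec.Relation.Unary.Linked using (Linked; linked?)
open import Data.Vec.Relation.Unary.Unique.Propositional using (Unique)
open import Function.Bundles using (_⇔_; mk⇔; module Equivalence)
open import Relation.Binary.PropositionalEquality using (_≡_)
open import Relation.Nullary.Decidable using (Dec; map′; ¬?; _×-dec_; _→-dec_)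

-- All vectors of length k over Fin n, each listed exactly once.
vectors : (n k : ℕ) → List (Vec (Fin n) k)
vectors n zero    = [] ∷ []
vectors n (suc k) = cartesianProductWith _∷_ (allFin n) (vectors n k)

-- One-line notation, with the letters 1, …, n shifted to 0, …, n - 1.
Word : ℕ → Set
Word n = Vec (Fin n) n

unique? : {n : ℕ} (σ : Word n) → Dec (Unique σ)
unique? = allPairs? (λ x y → ¬? (x ≟ y))

-- A word of length n over n letters is a permutation exactly when its
-- letters are pairwise distinct.
S : (n : ℕ) → List (Word n)
S n = filter unique? (vectors n n)

_⇔-dec_ : {A B : Set} → Dec A → Dec B → Dec (A ⇔ B)
a? ⇔-dec b? = map′ (uncurry mk⇔) < to , from > ((a? →-dec b?) ×-dec (b? →-dec a?))
  where open Equivalence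

module _ {k n : ℕ} (q : Word k) (σ : Word n) where

  IsOccurrence : Vec (Fin n) k → Set
  IsOccurrence i =
    Linked _<_ i ×
    (∀ j l → lookup q j < lookup q l ⇔ lookup σ (lookup i j) < lookup σ (lookup i l))

  isOccurrence? : ∀ i → Dec (IsOccurrence i)
  isOccurrence? i =
    linked? _<?_ i ×-dec
    all? λ j → all? λ l →
      (lookup q j <? lookup q l) ⇔-dec (lookup σ (lookup i j) <? lookup σ (lookup i l))

  occurrences : ℕ
  occurrences = length (filter isOccurrence? (vectors n k))

  Avoids : Set
  Avoids = occurrences ≡ 0

  avoids? : Dec Avoids
  avoids? = occurrences ℕ.≟ 0

p123 p132 p213 p231 p312 p321 : Word 3
p123 = 0F ∷ 1F ∷ 2F ∷ []
p132 = 0F ∷ 2F ∷ 1F ∷ []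
p213 = 1F ∷ 0F ∷ 2F ∷ []
p231 = 1F ∷ 2F ∷ 0F ∷ []
p312 = 2F ∷ 0F ∷ 1F ∷ []
p321 = 2F ∷ 1F ∷ 0F ∷ []

S⟨132,213,231⟩ : (n : ℕ) → List (Word n)
S⟨132,213,231⟩ n =
  filter (λ σ → avoids? p132 σ ×-dec avoids? p213 σ ×-dec avoids? p231 σ) (S n)

f : {k : ℕ} → Word k → ℕ → ℕ
f q n = sum (List.map (occurrences q) (S⟨132,213,231⟩ n))

{-# OPTIONS --safe #-}
module Submission where

-- A permutation of length n avoiding 132, 213 and 231 is determined by the
-- position m of its least letter: the letters before m exceed all later ones
-- and the letters from m on increase, so it is n ⋯ (n - m + 1) 1 2 ⋯ (n - m).
-- An index triple i < j < l is then an occurrence of 123 iff m ≤ i, of 312 iff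
-- i < m ≤ j, and of 321 iff j < m. Summing over m as well, the first two count
-- the 4-subsets m < i + 1 < j + 1 < l + 1 and i < m < j + 1 < l + 1 of
-- {0, …, n}; in the third, m and l range independently beyond j, which gives
-- squares (n - 1 - j)² to be summed over i < j.

open import Defs
open import Data.Bool.Base using (true; false; if_then_else_)
open import Data.Empty using (⊥)
open import Data.Fin.Base using (Fin; zero; suc; toℕ; fromℕ<; opposite; punchOut)
  renaming (_<_ to _<ᶠ_; _≤_ to _≤ᶠ_)
open import Data.Fin.Patterns using (0F; 1F; 2F)
open import Data.Fin.Properties as Fin
  using (toℕ<n; toℕ-fromℕ<; toℕ-injective; opposite-prop; punchOut-injective; injective⇒≤)
open import Data.Integer.Base using (+_)
import Data.Integer.Base as ℤ using (_*_)
import Data.Integer.Properties as ℤ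
open import Data.List.Base as List using (List; []; _∷_; _++_; length; filter; allFin; cartesianProductWith; tabulate)
open import Data.List.Membership.Propositional using (_∈_; lose)
open import Data.List.Membership.Propositional.Properties
  using (∈-cartesianProductWith⁺; ∈-filter⁺; ∈-filter⁻; ∈-allFin; ∈-map⁺; ∈-map⁻)
open import Data.List.Membership.Propositional.Properties.WithK using (unique∧set⇒bag)
open import Data.List.Properties using (filter-++; length-++; filter-some; filter-none; map-tabulate)
open import Data.List.Relation.Binary.BagAndSetEquality using (∼bag⇒↭)
open import Data.List.Relation.Binary.Permutation.Propositional using (_↭_)
open import Data.List.Relation.Binary.Permutation.Propositional.Properties using () renaming (map⁺ to ↭-map⁺)
import Data.List.Relation.Unary.All as All
open import Data.List.Relation.Unary.Any using (here)
import Data.List.Relation.Unary.AllPairs as AllPairs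
open import Data.List.Relation.Unary.Unique.Propositional using () renaming (Unique to Uniqueᴸ)
import Data.List.Relation.Unary.Unique.Propositional.Properties as Uniqueᴸ
open import Data.Nat.Base using (ℕ; zero; suc; NonZero; _+_; _*_; _∸_; _^_; _≤_; _<_; z≤n; s≤s; s≤s⁻¹)
open import Data.Nat.Combinatorics using (_C_; nC1≡n; nCk+nC[k+1]≡[n+1]C[k+1])
open import Data.Nat.ListAction using (sum)
open import Data.Nat.ListAction.Properties using (sum-↭)
import Data.Nat.Properties as ℕ
open import Data.Nat.Tactic.RingSolver using (solve-∀)
open import Data.Product.Base using (_×_; _,_; proj₁; proj₂; ∃)
open import Data.Rational.Base using (_/_)
open import Data.Rational.Properties using (fromℚᵘ-cong)
open import Data.Rational.Unnormalised.Base using (mkℚᵘ; *≡*)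
open import Data.Vec.Base as Vec using (Vec; []; _∷_; lookup)
open import Data.Vec.Properties using (lookup∘tabulate; tabulate∘lookup; tabulate-cong; ∷-injective)
open import Data.Vec.Relation.Unary.Linked using ([-]; _∷_)
open import Data.Vec.Relation.Unary.Unique.Propositional using (Unique)
import Data.Vec.Relation.Unary.Unique.Propositional.Properties as Unique
open import Algebra.Properties.Semiring.Sum ℕ.+-*-semiring
  using (sum-syntax; sum-cong-≗; ∑-comm; *-distribˡ-sum)
open import Function.Base using (_∘_)
open import Function.Bundles using (_⇔_; mk⇔; module Equivalence)
open import Function.Definitions using (Injective)
open import Function.Construct.Composition using (_⇔-∘_)
open import Relation.Binary.Definitions using (tri<; tri≈; tri>)
open import Relation.Binary.PropositionalEquality
open import Relation.Nullary using (Dec; does; yes; no; ¬_; contradiction)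
open import Relation.Nullary.Decidable using (True; toWitness; does-⇔; _×-dec_)
open import Relation.Unary using (Decidable)
open Equivalence using (to; from)

private
  variable
    k n : ℕ

-- V-shaped permutations

-- Only the left index is compared with `m`, so a pair straddling `m` counts as a descent. Hence the
-- relative order of all letters is fixed, which a mere fall up to `m` and rise after it would not
-- ensure.
VShaped : Fin n → (Fin n → Fin n) → Set
VShaped m g = ∀ {i j} → i <ᶠ j → (m ≤ᶠ i → g i <ᶠ g j) × (i <ᶠ m → g j <ᶠ g i)

VShaped-resp-≗ : ∀ {m : Fin n} {g h} → g ≗ h → VShaped m g → VShaped m h
VShaped-resp-≗ {m = m} g≗h shape {i} {j} i<j =
  subst₂ (λ x y → (m ≤ᶠ i → x <ᶠ y) × (i <ᶠ m → y <ᶠ x)) (g≗h i) (g≗h j) (shape i<j)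

letter : Fin n → Fin n → Fin n
letter m i with i Fin.<? m
... | yes _ = opposite i
... | no _  = fromℕ< (ℕ.≤-<-trans (ℕ.m∸n≤m (toℕ i) (toℕ m)) (toℕ<n i))

toℕ-letter-< : {m i : Fin n} → i <ᶠ m → toℕ (letter m i) ≡ n ∸ suc (toℕ i)
toℕ-letter-< {m = m} {i} i<m with i Fin.<? m
... | yes _   = opposite-prop i
... | no  i≮m = contradiction i<m i≮m

toℕ-letter-≥ : {m i : Fin n} → m ≤ᶠ i → toℕ (letter m i) ≡ toℕ i ∸ toℕ m
toℕ-letter-≥ {m = m} {i} m≤i with i Fin.<? m
... | yes i<m = contradiction m≤i (ℕ.<⇒≱ i<m)
... | no  _   = toℕ-fromℕ< _

letter-VShaped : (m : Fin n) → VShaped m (letter m)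
letter-VShaped {n} m {i} {j} i<j = increasing , decreasing
  where
  increasing : m ≤ᶠ i → letter m i <ᶠ letter m j
  increasing m≤i = subst₂ _<_ (sym (toℕ-letter-≥ m≤i)) (sym (toℕ-letter-≥ {m = m} {j} (ℕ.≤-trans m≤i (ℕ.<⇒≤ i<j))))
    (ℕ.∸-monoˡ-< i<j m≤i)

  decreasing : i <ᶠ m → letter m j <ᶠ letter m i
  decreasing i<m rewrite toℕ-letter-< {m = m} {i} i<m with j Fin.<? m
  ... | yes j<m rewrite opposite-prop j = ℕ.∸-monoʳ-< (s≤s i<j) (toℕ<n j)
  -- Across `m` the bound is j - m < n - m ≤ n - (i + 1).
  ... | no  j≮m rewrite toℕ-fromℕ< (ℕ.≤-<-trans (ℕ.m∸n≤m (toℕ j) (toℕ m)) (toℕ<n j)) =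
    ℕ.<-≤-trans (ℕ.∸-monoˡ-< (toℕ<n j) (ℕ.≮⇒≥ j≮m)) (ℕ.∸-monoʳ-≤ n i<m)

VShaped⇒injective : ∀ {m : Fin n} {g} → VShaped m g → Injective _≡_ _≡_ g
VShaped⇒injective {m = m} {g} shape {i} {j} gi≡gj with Fin.<-cmp i j
... | tri≈ _ i≡j _ = i≡j
... | tri< i<j _ _ with toℕ i ℕ.<? toℕ m
...   | yes i<m = contradiction (sym gi≡gj) (Fin.<⇒≢ (proj₂ (shape i<j) i<m))
...   | no  i≮m = contradiction gi≡gj (Fin.<⇒≢ (proj₁ (shape i<j) (ℕ.≮⇒≥ i≮m)))
VShaped⇒injective {m = m} {g} shape {i} {j} gi≡gj | tri> _ _ j<i with toℕ j ℕ.<? toℕ m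
...   | yes j<m = contradiction gi≡gj (Fin.<⇒≢ (proj₂ (shape j<i) j<m))
...   | no  j≮m = contradiction (sym gi≡gj) (Fin.<⇒≢ (proj₁ (shape j<i) (ℕ.≮⇒≥ j≮m)))

-- Pigeonhole: punching out a missed value would leave an injection from `suc n` elements into `n`.
injective⇒surjective : {g : Fin n → Fin n} → Injective _≡_ _≡_ g → ∀ y → ∃ λ x → g x ≡ y
injective⇒surjective {suc n} {g} inj y with Fin.any? (λ x → g x Fin.≟ y)
... | yes hit  = hit
... | no  miss = contradiction
  (injective⇒≤ {f = λ x → punchOut (y≢g x)} (λ {x} {x′} eq → inj (punchOut-injective (y≢g x) (y≢g x′) eq)))
  ℕ.1+n≰n
  where
  y≢g : ∀ x → y ≢ g x
  y≢g x y≡gx = miss (x , sym y≡gx)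

-- The value g i is the number of values of g below it, and h embeds
-- those below h i.
order-preserving⇒≤ : {g h : Fin n → Fin n} → Injective _≡_ _≡_ g →
  (∀ {i j} → g i <ᶠ g j → h i <ᶠ h j) → ∀ i → g i ≤ᶠ h i
order-preserving⇒≤ {n} {g} {h} inj mono i = go (toℕ (g i)) i refl
  where
  go : ∀ v i → toℕ (g i) ≡ v → v ≤ toℕ (h i)
  go zero    i eq = z≤n
  -- The induction is on the value: the position j with g j = v has v ≤ h j by induction, and h j <
  -- h i.
  go (suc v) i eq with injective⇒surjective inj (fromℕ< v<n)
    where
    v<n : v < n
    v<n = ℕ.<-trans (ℕ.≤-reflexive (sym eq)) (toℕ<n (g i))
  ... | j , gj≡v = ℕ.≤-<-trans (go v j toℕ-gj≡v) (mono (ℕ.≤-reflexive (trans (cong suc toℕ-gj≡v) (sym eq))))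
    where
    toℕ-gj≡v : toℕ (g j) ≡ v
    toℕ-gj≡v = trans (cong toℕ gj≡v) (toℕ-fromℕ< _)

-- Which of two letters is larger depends only on whether the lesser of their positions lies before
-- `m`, and this is the same for `g` and `h`.
VShaped-order : ∀ {m : Fin n} {g h} → VShaped m g → VShaped m h →
  ∀ {i j} → g i <ᶠ g j → h i <ᶠ h j
VShaped-order {m = m} {g} {h} g-shape h-shape {i} {j} gi<gj with Fin.<-cmp i j
... | tri≈ _ refl _ = contradiction gi<gj (ℕ.<-irrefl refl)
... | tri< i<j _ _ with toℕ i ℕ.<? toℕ m
...   | yes i<m = contradiction gi<gj (ℕ.<-asym (proj₂ (g-shape i<j) i<m))
...   | no  i≮m = proj₁ (h-shape i<j) (ℕ.≮⇒≥ i≮m)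
VShaped-order {m = m} {g} {h} g-shape h-shape {i} {j} gi<gj | tri> _ _ j<i with toℕ j ℕ.<? toℕ m
...   | yes j<m = proj₂ (h-shape j<i) j<m
...   | no  j≮m = contradiction gi<gj (ℕ.<-asym (proj₁ (g-shape j<i) (ℕ.≮⇒≥ j≮m)))

VShaped-unique : ∀ {m : Fin n} {g h} → VShaped m g → VShaped m h → g ≗ h
VShaped-unique {g = g} {h} g-shape h-shape i = toℕ-injective (ℕ.≤-antisym
  (order-preserving⇒≤ {g = g} {h} (VShaped⇒injective g-shape) (VShaped-order g-shape h-shape) i)
  (order-preserving⇒≤ {g = h} {g} (VShaped⇒injective h-shape) (VShaped-order h-shape g-shape) i))

-- Take `m` to be the position of the letter 0. A pair that breaks the shape forms a forbidden
-- pattern together with `m`: 132 if `m` lies to its left, 213 if between, 231 if to its right.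
avoiding⇒VShaped : {g : Fin (suc n) → Fin (suc n)} → Injective _≡_ _≡_ g →
  (∀ {i j l} → i <ᶠ j → j <ᶠ l → ¬ (g i <ᶠ g l × g l <ᶠ g j)) →
  (∀ {i j l} → i <ᶠ j → j <ᶠ l → ¬ (g j <ᶠ g i × g i <ᶠ g l)) →
  (∀ {i j l} → i <ᶠ j → j <ᶠ l → ¬ (g l <ᶠ g i × g i <ᶠ g j)) →
  ∃ λ m → VShaped m g
avoiding⇒VShaped {n} {g} inj no132 no213 no231 with injective⇒surjective inj zero
... | m , gm≡0 = m , shape
  where
  least : ∀ {i} → i ≢ m → g m <ᶠ g i
  least i≢m rewrite gm≡0 = ℕ.n≢0⇒n>0 λ gi≡0 → i≢m (inj (trans (toℕ-injective gi≡0) (sym gm≡0)))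

  shape : VShaped m g
  shape {i} {j} i<j = increasing , decreasing
    where
    increasing : m ≤ᶠ i → g i <ᶠ g j
    increasing m≤i with Fin.<-cmp m i | Fin.<-cmp (g i) (g j)
    ... | tri> _ _ i<m  | _              = contradiction m≤i (ℕ.<⇒≱ i<m)
    ... | tri≈ _ refl _ | _              = least (Fin.<⇒≢ i<j ∘ sym)
    ... | tri< _ _ _    | tri< gi<gj _ _ = gi<gj
    ... | tri< _ _ _    | tri≈ _ gi≡gj _ = contradiction (inj gi≡gj) (Fin.<⇒≢ i<j)
    ... | tri< m<i _ _  | tri> _ _ gj<gi =
      contradiction (least (Fin.<⇒≢ (Fin.<-trans m<i i<j) ∘ sym) , gj<gi) (no132 m<i i<j)

    decreasing : i <ᶠ m → g j <ᶠ g i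
    decreasing i<m with Fin.<-cmp (g i) (g j) | Fin.<-cmp j m
    ... | tri> _ _ gj<gi | _              = gj<gi
    ... | tri≈ _ gi≡gj _ | _              = contradiction (inj gi≡gj) (Fin.<⇒≢ i<j)
    ... | tri< _ _ _     | tri≈ _ refl _  = least (Fin.<⇒≢ i<m)
    ... | tri< gi<gj _ _ | tri< j<m _ _   = contradiction (least (Fin.<⇒≢ i<m) , gi<gj) (no231 i<j j<m)
    ... | tri< gi<gj _ _ | tri> _ _ m<j   = contradiction (least (Fin.<⇒≢ i<m) , gi<gj) (no213 i<m m<j)

-- Occurrences of patterns of length 3

Inverse? : (q r : Word 3) → Dec (∀ a → lookup q (lookup r a) ≡ a × lookup r (lookup q a) ≡ a)
Inverse? q r = Fin.all? λ a → lookup q (lookup r a) Fin.≟ a ×-dec lookup r (lookup q a) Fin.≟ a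

-- The inverse r of q lists the positions of q by increasing letter.
occurrence⇔ : (q r : Word 3) {_ : True (Inverse? q r)} (σ : Word n) (i j l : Fin n) →
  let s = λ a → lookup σ (lookup (i ∷ j ∷ l ∷ []) (lookup r a)) in
  IsOccurrence q σ (i ∷ j ∷ l ∷ []) ⇔ (i <ᶠ j × j <ᶠ l × s 0F <ᶠ s 1F × s 1F <ᶠ s 2F)
occurrence⇔ q r {inv} σ i j l = mk⇔ unpack pack
  where
  v = i ∷ j ∷ l ∷ []

  s t : Fin 3 → Fin _
  t a = lookup σ (lookup v a)
  s a = t (lookup r a)

  qr : ∀ a → lookup q (lookup r a) ≡ a
  qr a = proj₁ (toWitness inv a)

  rq : ∀ a → lookup r (lookup q a) ≡ a
  rq a = proj₂ (toWitness inv a)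

  unpack : IsOccurrence q σ v → i <ᶠ j × j <ᶠ l × s 0F <ᶠ s 1F × s 1F <ᶠ s 2F
  unpack (i<j ∷ j<l ∷ [-] , iff) = i<j , j<l , step (ℕ.n<1+n 0) , step (ℕ.n<1+n 1)
    where
    step : ∀ {a b} → a <ᶠ b → s a <ᶠ s b
    step {a} {b} a<b = to (iff (lookup r a) (lookup r b)) (subst₂ _<ᶠ_ (sym (qr a)) (sym (qr b)) a<b)

  pack : i <ᶠ j × j <ᶠ l × s 0F <ᶠ s 1F × s 1F <ᶠ s 2F → IsOccurrence q σ v
  pack (i<j , j<l , s₀<s₁ , s₁<s₂) = i<j ∷ j<l ∷ [-] , λ a b → mk⇔ (preserve a b) (reflect a b)
    where
    s-mono : ∀ a b → a <ᶠ b → s a <ᶠ s b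
    s-mono 0F 1F _ = s₀<s₁
    s-mono 0F 2F _ = ℕ.<-trans s₀<s₁ s₁<s₂
    s-mono 1F 2F _ = s₁<s₂
    s-mono 1F 1F (s≤s ())
    s-mono 2F 1F (s≤s ())
    s-mono 2F 2F (s≤s (s≤s ()))

    preserve : ∀ a b → lookup q a <ᶠ lookup q b → t a <ᶠ t b
    preserve a b qa<qb = subst₂ (λ x y → t x <ᶠ t y) (rq a) (rq b) (s-mono (lookup q a) (lookup q b) qa<qb)

    -- Preservation of a strict total order already gives reflection; equal letters of `q` come from
    -- equal positions because `r` inverts `q`.
    reflect : ∀ a b → t a <ᶠ t b → lookup q a <ᶠ lookup q b
    reflect a b ta<tb with Fin.<-cmp (lookup q a) (lookup q b)
    ... | tri< qa<qb _ _ = qa<qb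
    ... | tri> _ _ qb<qa = contradiction ta<tb (ℕ.<-asym (preserve b a qb<qa))
    ... | tri≈ _ qa≡qb _ with trans (sym (rq a)) (trans (cong (lookup r) qa≡qb) (rq b))
    ...   | refl = contradiction ta<tb (ℕ.<-irrefl refl)

-- The enumeration of vectors, and avoidance as absence of occurrences

∈-vectors : (v : Vec (Fin n) k) → v ∈ vectors n k
∈-vectors []      = here refl
∈-vectors (x ∷ v) = ∈-cartesianProductWith⁺ _∷_ (∈-allFin x) (∈-vectors v)

vectors-unique : ∀ n k → Uniqueᴸ (vectors n k)
vectors-unique n zero    = All.[] AllPairs.∷ AllPairs.[]
vectors-unique n (suc k) =
  Uniqueᴸ.cartesianProductWith⁺ _∷_ ∷-injective (Uniqueᴸ.allFin⁺ n) (vectors-unique n k)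

avoids⇔ : (q : Word k) (σ : Word n) → Avoids q σ ⇔ (∀ v → ¬ IsOccurrence q σ v)
avoids⇔ q σ = mk⇔
  (λ avoids v occ → ℕ.<⇒≢ (filter-some (isOccurrence? q σ) (lose (∈-vectors v) occ)) (sym avoids))
  (λ none → cong length (filter-none (isOccurrence? q σ) {xs = vectors _ _} (All.tabulate λ {v} _ → none v)))

-- The permutations avoiding 132, 213 and 231

avoider : Fin n → Word n
avoider m = Vec.tabulate (letter m)

avoider-VShaped : (m : Fin n) → VShaped m (lookup (avoider m))
avoider-VShaped m = VShaped-resp-≗ (λ i → sym (lookup∘tabulate (letter m) i)) (letter-VShaped m)

-- The letter 0 stands at position `m` of `avoider m`. If the two words agree, `letter m′` takes the
-- value 0 at both `m` and `m′`, and it is injective.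
avoider-injective : {m m′ : Fin n} → avoider m ≡ avoider m′ → m ≡ m′
avoider-injective {m = m} {m′} eq = VShaped⇒injective (letter-VShaped m′) (toℕ-injective (begin
  toℕ (letter m′ m)              ≡⟨ cong toℕ (lookup∘tabulate (letter m′) m) ⟨
  toℕ (lookup (avoider m′) m)    ≡⟨ cong (λ σ → toℕ (lookup σ m)) eq ⟨
  toℕ (lookup (avoider m) m)     ≡⟨ cong toℕ (lookup∘tabulate (letter m) m) ⟩
  toℕ (letter m m)               ≡⟨ toℕ-letter-≥ {m = m} ℕ.≤-refl ⟩
  toℕ m ∸ toℕ m                  ≡⟨ ℕ.n∸n≡0 (toℕ m) ⟩
  0                              ≡⟨ ℕ.n∸n≡0 (toℕ m′) ⟨
  toℕ m′ ∸ toℕ m′                ≡⟨ toℕ-letter-≥ {m = m′} ℕ.≤-refl ⟨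
  toℕ (letter m′ m′)             ∎))
  where open ≡-Reasoning

module _ {m : Fin n} (σ : Word n) (shape : VShaped m (lookup σ)) where

  -- This and `descent⇒<` are converses of the two halves of `VShaped`: on the wrong side of `m` the
  -- other half would reverse the inequality.
  ascent⇒≥ : ∀ {i j} → i <ᶠ j → lookup σ i <ᶠ lookup σ j → m ≤ᶠ i
  ascent⇒≥ {i} i<j σi<σj with toℕ i ℕ.<? toℕ m
  ... | yes i<m = contradiction σi<σj (ℕ.<-asym (proj₂ (shape i<j) i<m))
  ... | no  i≮m = ℕ.≮⇒≥ i≮m

  descent⇒< : ∀ {i j} → i <ᶠ j → lookup σ j <ᶠ lookup σ i → i <ᶠ m
  descent⇒< {i} i<j σj<σi with toℕ i ℕ.<? toℕ m
  ... | yes i<m = i<m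
  ... | no  i≮m = contradiction σj<σi (ℕ.<-asym (proj₁ (shape i<j) (ℕ.≮⇒≥ i≮m)))

  -- Each of 132, 213 and 231 has an ascent starting at its first index i and a descent starting at
  -- i or later. The ascent forces m ≤ i, the descent i < m.
  VShaped⇒avoids-132 : Avoids p132 σ
  VShaped⇒avoids-132 = from (avoids⇔ p132 σ) λ { (i ∷ j ∷ l ∷ []) occ →
    case (to (occurrence⇔ p132 p132 σ i j l) occ) }
    where
    case : ∀ {i j l} → (i <ᶠ j × j <ᶠ l × lookup σ i <ᶠ lookup σ l × lookup σ l <ᶠ lookup σ j) → ⊥
    case (i<j , j<l , σi<σl , σl<σj) =
      ℕ.<⇒≱ (ℕ.<-trans i<j (descent⇒< j<l σl<σj)) (ascent⇒≥ (Fin.<-trans i<j j<l) σi<σl)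

  VShaped⇒avoids-213 : Avoids p213 σ
  VShaped⇒avoids-213 = from (avoids⇔ p213 σ) λ { (i ∷ j ∷ l ∷ []) occ →
    case (to (occurrence⇔ p213 p213 σ i j l) occ) }
    where
    case : ∀ {i j l} → (i <ᶠ j × j <ᶠ l × lookup σ j <ᶠ lookup σ i × lookup σ i <ᶠ lookup σ l) → ⊥
    case (i<j , j<l , σj<σi , σi<σl) =
      ℕ.<⇒≱ (descent⇒< i<j σj<σi) (ascent⇒≥ (Fin.<-trans i<j j<l) σi<σl)

  VShaped⇒avoids-231 : Avoids p231 σ
  -- The patterns 132 and 213 are involutions, while 231 has 312 as its inverse.
  VShaped⇒avoids-231 = from (avoids⇔ p231 σ) λ { (i ∷ j ∷ l ∷ []) occ →
    case (to (occurrence⇔ p231 p312 σ i j l) occ) }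
    where
    case : ∀ {i j l} → (i <ᶠ j × j <ᶠ l × lookup σ l <ᶠ lookup σ i × lookup σ i <ᶠ lookup σ j) → ⊥
    case (i<j , j<l , σl<σi , σi<σj) =
      ℕ.<⇒≱ (descent⇒< (Fin.<-trans i<j j<l) σl<σi) (ascent⇒≥ i<j σi<σj)

  occurrence-123⇔ : ∀ i j l → IsOccurrence p123 σ (i ∷ j ∷ l ∷ []) ⇔ (m ≤ᶠ i × i <ᶠ j × j <ᶠ l)
  occurrence-123⇔ i j l = mk⇔
    (λ (i<j , j<l , σi<σj , σj<σl) → ascent⇒≥ i<j σi<σj , i<j , j<l)
    (λ (m≤i , i<j , j<l) → i<j , j<l , proj₁ (shape i<j) m≤i , proj₁ (shape j<l) (ℕ.≤-trans m≤i (ℕ.<⇒≤ i<j)))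
    ⇔-∘ occurrence⇔ p123 p123 σ i j l

  -- The comparison i < j is absorbed into i < m ≤ j, so that a chain of three comparisons remains
  -- to be summed.
  occurrence-312⇔ : ∀ i j l → IsOccurrence p312 σ (i ∷ j ∷ l ∷ []) ⇔ (i <ᶠ m × m ≤ᶠ j × j <ᶠ l)
  occurrence-312⇔ i j l = mk⇔
    (λ (i<j , j<l , σj<σl , σl<σi) → descent⇒< (Fin.<-trans i<j j<l) σl<σi , ascent⇒≥ j<l σj<σl , j<l)
    (λ (i<m , m≤j , j<l) → let i<j = ℕ.<-≤-trans i<m m≤j in
      i<j , j<l , proj₁ (shape j<l) m≤j , proj₂ (shape (Fin.<-trans i<j j<l)) i<m)
    ⇔-∘ occurrence⇔ p312 p231 σ i j l

  -- Here the three comparisons branch at j: both `m` and l lie beyond it, with no relation between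
  -- them.
  occurrence-321⇔ : ∀ i j l → IsOccurrence p321 σ (i ∷ j ∷ l ∷ []) ⇔ (i <ᶠ j × j <ᶠ m × j <ᶠ l)
  occurrence-321⇔ i j l = mk⇔
    (λ (i<j , j<l , σl<σj , σj<σi) → i<j , descent⇒< j<l σl<σj , j<l)
    (λ (i<j , j<m , j<l) → i<j , j<l , proj₂ (shape j<l) j<m , proj₂ (shape i<j) (ℕ.<-trans i<j j<m))
    ⇔-∘ occurrence⇔ p321 p321 σ i j l

AvoidsAll : Word n → Set
AvoidsAll σ = Avoids p132 σ × Avoids p213 σ × Avoids p231 σ

avoidsAll? : Decidable (AvoidsAll {n})
avoidsAll? σ = avoids? p132 σ ×-dec avoids? p213 σ ×-dec avoids? p231 σ

avoider∈S⟨132,213,231⟩ : (m : Fin n) → avoider m ∈ S⟨132,213,231⟩ n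
avoider∈S⟨132,213,231⟩ m = ∈-filter⁺ avoidsAll?
  (∈-filter⁺ unique? (∈-vectors (avoider m)) (Unique.tabulate⁺ (VShaped⇒injective (letter-VShaped m))))
  (VShaped⇒avoids-132 σ shape , VShaped⇒avoids-213 σ shape , VShaped⇒avoids-231 σ shape)
  where
  σ = avoider m
  shape = avoider-VShaped m

-- The empty word avoids every pattern of length 3 but has no position `m`, hence `NonZero n`.
avoidsAll⇒avoider : .{{_ : NonZero n}} (σ : Word n) → Unique σ → AvoidsAll σ → ∃ λ m → σ ≡ avoider m
avoidsAll⇒avoider {suc n} σ unique (avoids132 , avoids213 , avoids231)
  with avoiding⇒VShaped {g = lookup σ} (λ {i} {j} → Unique.lookup-injective unique i j)
    (λ {i} {j} {l} i<j j<l (x , y) → to (avoids⇔ p132 σ) avoids132 (i ∷ j ∷ l ∷ [])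
      (from (occurrence⇔ p132 p132 σ i j l) (i<j , j<l , x , y)))
    (λ {i} {j} {l} i<j j<l (x , y) → to (avoids⇔ p213 σ) avoids213 (i ∷ j ∷ l ∷ [])
      (from (occurrence⇔ p213 p213 σ i j l) (i<j , j<l , x , y)))
    (λ {i} {j} {l} i<j j<l (x , y) → to (avoids⇔ p231 σ) avoids231 (i ∷ j ∷ l ∷ [])
      (from (occurrence⇔ p231 p312 σ i j l) (i<j , j<l , x , y)))
... | m , shape = m , trans (sym (tabulate∘lookup σ)) (tabulate-cong (VShaped-unique shape (letter-VShaped m)))

S⟨132,213,231⟩⇒avoider : .{{_ : NonZero n}} {σ : Word n} → σ ∈ S⟨132,213,231⟩ n → ∃ λ m → σ ≡ avoider m
S⟨132,213,231⟩⇒avoider {n} {σ = σ} σ∈ =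
  let σ∈S , avoids = ∈-filter⁻ avoidsAll? {xs = S n} σ∈
      _ , unique   = ∈-filter⁻ unique? {xs = vectors n n} σ∈S
  in avoidsAll⇒avoider σ unique avoids

-- Both lists are free of duplicates and have the same members, so they agree as multisets, which is
-- what a sum over them depends on.
S⟨132,213,231⟩-↭ : ∀ n .{{_ : NonZero n}} → S⟨132,213,231⟩ n ↭ List.map avoider (allFin n)
S⟨132,213,231⟩-↭ n = ∼bag⇒↭ (unique∧set⇒bag
  (Uniqueᴸ.filter⁺ avoidsAll? (Uniqueᴸ.filter⁺ unique? (vectors-unique n n)))
  (Uniqueᴸ.map⁺ avoider-injective (Uniqueᴸ.allFin⁺ n))
  (mk⇔ into onto))
  where
  into : ∀ {σ} → σ ∈ S⟨132,213,231⟩ n → σ ∈ List.map avoider (allFin n)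
  into σ∈ = let m , σ≡ = S⟨132,213,231⟩⇒avoider σ∈ in
    subst (_∈ List.map avoider (allFin n)) (sym σ≡) (∈-map⁺ avoider (∈-allFin m))

  onto : ∀ {σ} → σ ∈ List.map avoider (allFin n) → σ ∈ S⟨132,213,231⟩ n
  onto σ∈ = let m , _ , σ≡ = ∈-map⁻ avoider {xs = allFin n} σ∈ in
    subst (_∈ S⟨132,213,231⟩ n) (sym σ≡) (avoider∈S⟨132,213,231⟩ m)

-- Counting by sums of indicators

-- The Iverson bracket. It turns conjunctions into products, whose factors can be pulled out of
-- inner sums.
⟦_⟧ : {A : Set} → Dec A → ℕ
⟦ a? ⟧ = if does a? then 1 else 0

⟦⟧-cong : {A B : Set} → A ⇔ B → (a? : Dec A) (b? : Dec B) → ⟦ a? ⟧ ≡ ⟦ b? ⟧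
⟦⟧-cong A⇔B a? b? = cong (if_then 1 else 0) (does-⇔ A⇔B a? b?)

⟦⟧-×-dec : {A B : Set} (a? : Dec A) (b? : Dec B) → ⟦ a? ×-dec b? ⟧ ≡ ⟦ a? ⟧ * ⟦ b? ⟧
⟦⟧-×-dec a? b? with does a?
... | false = refl
... | true  = sym (ℕ.+-identityʳ _)

sum-tabulate : (g : Fin n → ℕ) → sum (tabulate g) ≡ ∑[ i < n ] g i
sum-tabulate {zero}  g = refl
sum-tabulate {suc n} g = cong₂ _+_ refl (sum-tabulate (g ∘ suc))

f-∑ : (q : Word k) → ∀ n .{{_ : NonZero n}} → f q n ≡ ∑[ m < n ] occurrences q (avoider m)
f-∑ q n = begin
  sum (List.map occ (S⟨132,213,231⟩ n))             ≡⟨ sum-↭ (↭-map⁺ occ (S⟨132,213,231⟩-↭ n)) ⟩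
  sum (List.map occ (List.map avoider (allFin n)))  ≡⟨ cong (sum ∘ List.map occ) (map-tabulate (λ m → m) (avoider {n})) ⟩
  sum (List.map occ (tabulate (avoider {n})))       ≡⟨ cong sum (map-tabulate (avoider {n}) occ) ⟩
  sum (tabulate (λ (m : Fin n) → occ (avoider m)))  ≡⟨ sum-tabulate {n} (λ m → occ (avoider m)) ⟩
  ∑[ m < n ] occ (avoider m)                        ∎
  where
  open ≡-Reasoning
  occ = occurrences {n = n} q

length-filter-map : {A B : Set} {P : B → Set} (P? : Decidable P) (g : A → B) (xs : List A) →
  length (filter P? (List.map g xs)) ≡ length (filter (P? ∘ g) xs)
length-filter-map P? g []       = refl
length-filter-map P? g (x ∷ xs) with does (P? (g x))
... | false = length-filter-map P? g xs
... | true  = cong suc (length-filter-map P? g xs)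

length-filter-cartesianProductWith : {A B C : Set} {P : C → Set} (P? : Decidable P) (g : A → B → C)
  (h : Fin n → A) (ys : List B) →
  length (filter P? (cartesianProductWith g (tabulate h) ys)) ≡ ∑[ i < n ] length (filter (P? ∘ g (h i)) ys)
length-filter-cartesianProductWith {zero}  P? g h ys = refl
length-filter-cartesianProductWith {suc n} P? g h ys = begin
  length (filter P? (xs ++ zs))                     ≡⟨ cong length (filter-++ P? xs zs) ⟩
  length (filter P? xs ++ filter P? zs)             ≡⟨ length-++ (filter P? xs) ⟩
  length (filter P? xs) + length (filter P? zs)     ≡⟨ cong₂ _+_ (length-filter-map P? (g (h zero)) ys)
                                                        (length-filter-cartesianProductWith P? g (h ∘ suc) ys) ⟩
  ∑[ i < suc n ] length (filter (P? ∘ g (h i)) ys)  ∎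
  where
  open ≡-Reasoning
  xs = List.map (g (h zero)) ys
  zs = cartesianProductWith g (tabulate (h ∘ suc)) ys

length-filter-vectors₃ : {P : Vec (Fin n) 3 → Set} (P? : Decidable P) →
  length (filter P? (vectors n 3)) ≡ ∑[ i < n ] ∑[ j < n ] ∑[ l < n ] ⟦ P? (i ∷ j ∷ l ∷ []) ⟧
length-filter-vectors₃ {n} P? =
  trans (split P?) (sum-cong-≗ {n} λ i →
  trans (split (P? ∘ (i ∷_))) (sum-cong-≗ {n} λ j →
  trans (split (P? ∘ (i ∷_) ∘ (j ∷_))) (sum-cong-≗ λ l → singleton (P? ∘ (i ∷_) ∘ (j ∷_) ∘ (l ∷_)))))
  where
  split : ∀ {k} {Q : Vec (Fin n) (suc k) → Set} (Q? : Decidable Q) →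
    length (filter Q? (vectors n (suc k))) ≡ ∑[ i < n ] length (filter (Q? ∘ (i ∷_)) (vectors n k))
  split {k} Q? = length-filter-cartesianProductWith Q? _∷_ (λ i → i) (vectors n k)

  singleton : {Q : Vec (Fin n) 0 → Set} (Q? : Decidable Q) → length (filter Q? ([] ∷ [])) ≡ ⟦ Q? [] ⟧
  singleton Q? with does (Q? [])
  ... | true  = refl
  ... | false = refl

-- A bracket depends only on the truth of its proposition, so the decision `isOccurrence?` may be
-- exchanged for three elementary ones.
f-∑⁴ : (q : Word 3) → ∀ n .{{_ : NonZero n}} {A B C : (m i j l : Fin n) → Set}
  (a? : ∀ m i j l → Dec (A m i j l)) (b? : ∀ m i j l → Dec (B m i j l)) (c? : ∀ m i j l → Dec (C m i j l)) →
  (∀ m i j l → IsOccurrence q (avoider m) (i ∷ j ∷ l ∷ []) ⇔ (A m i j l × B m i j l × C m i j l)) →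
  f q n ≡ ∑[ m < n ] ∑[ i < n ] ∑[ j < n ] ∑[ l < n ]
    (⟦ a? m i j l ⟧ * (⟦ b? m i j l ⟧ * ⟦ c? m i j l ⟧))
f-∑⁴ q n a? b? c? iff = trans (f-∑ q n) (sum-cong-≗ {n} λ m →
  trans (length-filter-vectors₃ (isOccurrence? q (avoider m)))
        (sum-cong-≗ {n} λ i → sum-cong-≗ {n} λ j → sum-cong-≗ λ l → indicator m i j l))
  where
  open ≡-Reasoning
  indicator : ∀ m i j l → ⟦ isOccurrence? q (avoider m) (i ∷ j ∷ l ∷ []) ⟧ ≡
    ⟦ a? m i j l ⟧ * (⟦ b? m i j l ⟧ * ⟦ c? m i j l ⟧)
  indicator m i j l = begin
    ⟦ o ⟧                  ≡⟨ ⟦⟧-cong (iff m i j l) o (a ×-dec b ×-dec c) ⟩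
    ⟦ a ×-dec b ×-dec c ⟧  ≡⟨ ⟦⟧-×-dec a (b ×-dec c) ⟩
    ⟦ a ⟧ * ⟦ b ×-dec c ⟧  ≡⟨ cong (⟦ a ⟧ *_) (⟦⟧-×-dec b c) ⟩
    ⟦ a ⟧ * (⟦ b ⟧ * ⟦ c ⟧) ∎
    where
    o = isOccurrence? q (avoider m) (i ∷ j ∷ l ∷ [])
    a = a? m i j l
    b = b? m i j l
    c = c? m i j l

-- Evaluation of the sums

-- As j runs from a to n - 1, the argument of `h` runs down from n - a - 1 to 0, so the sum is h 0 +
-- ⋯ + h (n - a - 1), and `h` is the difference sequence of `G`. For a ≥ n both sides are 0.
∑-telescope : ∀ {h G : ℕ → ℕ} → G 0 ≡ 0 → (∀ t → h t + G t ≡ G (suc t)) → ∀ n a →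
  ∑[ j < n ] (⟦ a ℕ.≤? toℕ j ⟧ * h (n ∸ suc (toℕ j))) ≡ G (n ∸ a)
∑-telescope {h} {G} G₀ step zero    a       = sym (trans (cong G (ℕ.0∸n≡0 a)) G₀)
∑-telescope {h} {G} G₀ step (suc n) zero    =
  trans (cong₂ _+_ (ℕ.*-identityˡ (h n)) (∑-telescope {h} {G} G₀ step n zero)) (step n)
∑-telescope {h} {G} G₀ step (suc n) (suc a) =
  -- The term at j = 0 vanishes by computation; in the others, lowering n, a and j together leaves
  -- the argument of `h` unchanged.
  trans (sum-cong-≗ λ (j : Fin n) → cong (_* h (n ∸ suc (toℕ j)))
          (⟦⟧-cong (mk⇔ s≤s⁻¹ s≤s) (suc a ℕ.≤? suc (toℕ j)) (a ℕ.≤? toℕ j)))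
        (∑-telescope {h} {G} G₀ step n a)

∑-factor : ∀ {n} x (g : Fin n → ℕ) {y} → ∑[ i < n ] g i ≡ y → ∑[ i < n ] (x * g i) ≡ x * y
∑-factor x g eq = trans (sym (*-distribˡ-sum x g)) (cong (x *_) eq)

pascal : ∀ k t → t C k + t C suc k ≡ suc t C suc k
pascal k t = nCk+nC[k+1]≡[n+1]C[k+1] t k

∑-beyond : (j : Fin n) → ∑[ l < n ] ⟦ j Fin.<? l ⟧ ≡ n ∸ suc (toℕ j)
∑-beyond {n} j = trans (sum-cong-≗ λ (l : Fin n) → sym (ℕ.*-identityʳ ⟦ j Fin.<? l ⟧))
  (∑-telescope {λ _ → 1} {λ t → t} refl (λ _ → refl) n (suc (toℕ j)))

-- The chain m ≤ i < j < l is summed from l outwards. Each sum is a hockey-stick identity raising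
-- the lower index of the binomial by one; the weak inequality raises the upper index from `n` to
-- `suc n`.
f-123 : ∀ n .{{_ : NonZero n}} → f p123 n ≡ suc n C 4
f-123 n = trans
  (f-∑⁴ p123 n (λ m i j l → m Fin.≤? i) (λ m i j l → i Fin.<? j) (λ m i j l → j Fin.<? l)
    (λ m → occurrence-123⇔ (avoider m) (avoider-VShaped m)))
  (trans (sum-cong-≗ {n} ∑-m)
    (∑-telescope {λ t → suc t C 3} {λ t → suc t C 4} refl (λ t → pascal 3 (suc t)) n 0))
  where
  ∑-ij : (m i : Fin n) →
    ∑[ j < n ] ∑[ l < n ] (⟦ m Fin.≤? i ⟧ * (⟦ i Fin.<? j ⟧ * ⟦ j Fin.<? l ⟧))
      ≡ ⟦ m Fin.≤? i ⟧ * ((n ∸ suc (toℕ i)) C 2)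
  ∑-ij m i = trans
    (sum-cong-≗ λ (j : Fin n) → ∑-factor {n} ⟦ m Fin.≤? i ⟧ (λ l → ⟦ i Fin.<? j ⟧ * ⟦ j Fin.<? l ⟧)
      (∑-factor {n} ⟦ i Fin.<? j ⟧ (λ l → ⟦ j Fin.<? l ⟧) (∑-beyond j)))
    (∑-factor {n} ⟦ m Fin.≤? i ⟧ (λ j → ⟦ i Fin.<? j ⟧ * (n ∸ suc (toℕ j)))
      (∑-telescope {λ t → t} {λ t → t C 2} refl
        (λ t → trans (cong (_+ t C 2) (sym (nC1≡n t))) (pascal 1 t)) n (suc (toℕ i))))

  ∑-m : (m : Fin n) →
    ∑[ i < n ] ∑[ j < n ] ∑[ l < n ] (⟦ m Fin.≤? i ⟧ * (⟦ i Fin.<? j ⟧ * ⟦ j Fin.<? l ⟧))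
      ≡ ⟦ 0 ℕ.≤? toℕ m ⟧ * (suc (n ∸ suc (toℕ m)) C 3)
  ∑-m m = trans (trans (sum-cong-≗ {n} (∑-ij m))
    (∑-telescope {λ t → t C 2} {λ t → t C 3} refl (pascal 2) n (toℕ m)))
    -- The sum over i ends in n - m, rewritten as 1 + (n - (m + 1)) to fit `∑-telescope`. The always
    -- true bracket supplies its lower bound a = 0.
    (trans (cong (_C 3) (ℕ.+-∸-assoc 1 (toℕ<n m))) (sym (ℕ.*-identityˡ _)))

-- The chain is now i < m ≤ j < l, so the sums over m and i are exchanged before it is summed from
-- its right end.
f-312 : ∀ n .{{_ : NonZero n}} → f p312 n ≡ suc n C 4
f-312 n = trans
  (f-∑⁴ p312 n (λ m i j l → i Fin.<? m) (λ m i j l → m Fin.≤? j) (λ m i j l → j Fin.<? l)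
    (λ m → occurrence-312⇔ (avoider m) (avoider-VShaped m)))
  (trans (∑-comm {n} {n} λ m i → ∑[ j < n ] ∑[ l < n ] (⟦ i Fin.<? m ⟧ * (⟦ m Fin.≤? j ⟧ * ⟦ j Fin.<? l ⟧)))
  (trans (sum-cong-≗ {n} ∑-i)
    (∑-telescope {λ t → suc t C 3} {λ t → suc t C 4} refl (λ t → pascal 3 (suc t)) n 0)))
  where
  ∑-im : (i m : Fin n) →
    ∑[ j < n ] ∑[ l < n ] (⟦ i Fin.<? m ⟧ * (⟦ m Fin.≤? j ⟧ * ⟦ j Fin.<? l ⟧))
      ≡ ⟦ i Fin.<? m ⟧ * (suc (n ∸ suc (toℕ m)) C 2)
  ∑-im i m = trans
    (sum-cong-≗ λ (j : Fin n) → ∑-factor {n} ⟦ i Fin.<? m ⟧ (λ l → ⟦ m Fin.≤? j ⟧ * ⟦ j Fin.<? l ⟧)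
      (∑-factor {n} ⟦ m Fin.≤? j ⟧ (λ l → ⟦ j Fin.<? l ⟧) (∑-beyond j)))
    (∑-factor {n} ⟦ i Fin.<? m ⟧ (λ j → ⟦ m Fin.≤? j ⟧ * (n ∸ suc (toℕ j))) (trans
      (∑-telescope {λ t → t} {λ t → t C 2} refl
        (λ t → trans (cong (_+ t C 2) (sym (nC1≡n t))) (pascal 1 t)) n (toℕ m))
      (cong (_C 2) (ℕ.+-∸-assoc 1 (toℕ<n m)))))

  ∑-i : (i : Fin n) →
    ∑[ m < n ] ∑[ j < n ] ∑[ l < n ] (⟦ i Fin.<? m ⟧ * (⟦ m Fin.≤? j ⟧ * ⟦ j Fin.<? l ⟧))
      ≡ ⟦ 0 ℕ.≤? toℕ i ⟧ * (suc (n ∸ suc (toℕ i)) C 3)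
  ∑-i i = trans (trans (sum-cong-≗ {n} (∑-im i))
    (∑-telescope {λ t → suc t C 2} {λ t → suc t C 3} refl (λ t → pascal 2 (suc t)) n (suc (toℕ i))))
    (sym (ℕ.*-identityˡ _))

-- The k-dimensional analogue of the square numbers: pyramid 2 t = t ².
pyramid : ℕ → ℕ → ℕ
pyramid k t = suc t C k + t C k

-- Pascal's rule in each of the two summands. In this form it serves as the step of `∑-telescope`.
pyramid-suc : ∀ k t → pyramid k t + pyramid (suc k) t ≡ pyramid (suc k) (suc t)
pyramid-suc k t = begin
  (suc t C k + t C k) + (suc t C suc k + t C suc k)  ≡⟨ interchange (suc t C k) (t C k) (suc t C suc k) (t C suc k) ⟩
  (suc t C k + suc t C suc k) + (t C k + t C suc k)  ≡⟨ cong₂ _+_ (pascal k (suc t)) (pascal k t) ⟩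
  suc (suc t) C suc k + suc t C suc k                ∎
  where
  open ≡-Reasoning
  interchange : ∀ a b c d → (a + b) + (c + d) ≡ (a + c) + (b + d)
  interchange = solve-∀

pyramid-2 : ∀ t → pyramid 2 t ≡ t * t
pyramid-2 zero    = refl
pyramid-2 (suc t) = begin
  pyramid 2 (suc t)              ≡⟨ pyramid-suc 1 t ⟨
  (suc t C 1 + t C 1) + pyramid 2 t  ≡⟨ cong₂ _+_ (cong₂ _+_ (nC1≡n (suc t)) (nC1≡n t)) (pyramid-2 t) ⟩
  (suc t + t) + t * t            ≡⟨ square t ⟩
  suc t * suc t                  ∎
  where
  open ≡-Reasoning
  square : ∀ t → (suc t + t) + t * t ≡ suc t * suc t
  square = solve-∀

-- The value `pyramid 3 (suc t)` is 1² + ⋯ + t², and the factor 6 clears the denominator of its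
-- classical formula.
pyramid-3 : ∀ t → 6 * pyramid 3 (suc t) ≡ t * (1 + t) * (1 + 2 * t)
pyramid-3 zero    = refl
pyramid-3 (suc t) = begin
  6 * pyramid 3 (2 + t)                               ≡⟨ cong (6 *_) (pyramid-suc 2 (suc t)) ⟨
  6 * (pyramid 2 (suc t) + pyramid 3 (suc t))         ≡⟨ ℕ.*-distribˡ-+ 6 (pyramid 2 (suc t)) (pyramid 3 (suc t)) ⟩
  6 * pyramid 2 (suc t) + 6 * pyramid 3 (suc t)       ≡⟨ cong₂ _+_ (cong (6 *_) (pyramid-2 (suc t))) (pyramid-3 t) ⟩
  6 * (suc t * suc t) + t * (1 + t) * (1 + 2 * t)     ≡⟨ poly t ⟩
  suc t * (1 + suc t) * (1 + 2 * suc t)               ∎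
  where
  open ≡-Reasoning
  poly : ∀ t → 6 * (suc t * suc t) + t * (1 + t) * (1 + 2 * t) ≡ suc t * (1 + suc t) * (1 + 2 * suc t)
  poly = solve-∀

-- The argument is written `2 + t` so that n - 2 and n - 1 become `t` and `1 + t`, without truncated
-- subtraction.
pyramid-4 : ∀ t → 12 * pyramid 4 (2 + t) ≡ (2 + t) * t * ((1 + t) * (1 + t))
pyramid-4 zero    = refl
pyramid-4 (suc t) = begin
  12 * pyramid 4 (3 + t)
    ≡⟨ cong (12 *_) (pyramid-suc 3 (2 + t)) ⟨
  12 * (pyramid 3 (2 + t) + pyramid 4 (2 + t))
    ≡⟨ regroup (pyramid 3 (2 + t)) (pyramid 4 (2 + t)) ⟩
  2 * (6 * pyramid 3 (2 + t)) + 12 * pyramid 4 (2 + t)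
    ≡⟨ cong₂ _+_ (cong (2 *_) (pyramid-3 (suc t))) (pyramid-4 t) ⟩
  2 * (suc t * (2 + t) * (1 + 2 * suc t)) + (2 + t) * t * ((1 + t) * (1 + t))
    ≡⟨ poly t ⟩
  (3 + t) * suc t * ((2 + t) * (2 + t)) ∎
  where
  open ≡-Reasoning
  regroup : ∀ a b → 12 * (a + b) ≡ 2 * (6 * a) + 12 * b
  regroup = solve-∀
  poly : ∀ t → 2 * (suc t * (2 + t) * (1 + 2 * suc t)) + (2 + t) * t * ((1 + t) * (1 + t))
             ≡ (3 + t) * suc t * ((2 + t) * (2 + t))
  poly = solve-∀

f-321 : ∀ n .{{_ : NonZero n}} → f p321 n ≡ pyramid 4 n
f-321 n = trans
  (f-∑⁴ p321 n (λ m i j l → i Fin.<? j) (λ m i j l → j Fin.<? m) (λ m i j l → j Fin.<? l)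
    (λ m → occurrence-321⇔ (avoider m) (avoider-VShaped m)))
  -- The sum over m moves inside that over i here and inside that over j in `∑-i`. For fixed j, the
  -- sums over m and l then give equal independent factors.
  (trans (∑-comm {n} {n} λ m i → ∑[ j < n ] ∑[ l < n ] (⟦ i Fin.<? j ⟧ * (⟦ j Fin.<? m ⟧ * ⟦ j Fin.<? l ⟧)))
  (trans (sum-cong-≗ {n} ∑-i)
    (∑-telescope {pyramid 3} {pyramid 4} refl (pyramid-suc 3) n 0)))
  where
  ∑-ij : (i j : Fin n) →
    ∑[ m < n ] ∑[ l < n ] (⟦ i Fin.<? j ⟧ * (⟦ j Fin.<? m ⟧ * ⟦ j Fin.<? l ⟧))
      ≡ ⟦ i Fin.<? j ⟧ * pyramid 2 (n ∸ suc (toℕ j))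
  ∑-ij i j = trans
    (sum-cong-≗ λ (m : Fin n) → ∑-factor {n} ⟦ i Fin.<? j ⟧ (λ l → ⟦ j Fin.<? m ⟧ * ⟦ j Fin.<? l ⟧)
      (∑-factor {n} ⟦ j Fin.<? m ⟧ (λ l → ⟦ j Fin.<? l ⟧) (∑-beyond j)))
    (∑-factor {n} ⟦ i Fin.<? j ⟧ (λ m → ⟦ j Fin.<? m ⟧ * (n ∸ suc (toℕ j))) (begin
      ∑[ m < n ] (⟦ j Fin.<? m ⟧ * (n ∸ suc (toℕ j)))
        ≡⟨ sum-cong-≗ (λ (m : Fin n) → ℕ.*-comm ⟦ j Fin.<? m ⟧ (n ∸ suc (toℕ j))) ⟩
      ∑[ m < n ] ((n ∸ suc (toℕ j)) * ⟦ j Fin.<? m ⟧)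
        ≡⟨ ∑-factor {n} (n ∸ suc (toℕ j)) (λ m → ⟦ j Fin.<? m ⟧) (∑-beyond j) ⟩
      (n ∸ suc (toℕ j)) * (n ∸ suc (toℕ j))
        ≡⟨ pyramid-2 (n ∸ suc (toℕ j)) ⟨
      pyramid 2 (n ∸ suc (toℕ j)) ∎))
    where open ≡-Reasoning

  ∑-i : (i : Fin n) →
    ∑[ m < n ] ∑[ j < n ] ∑[ l < n ] (⟦ i Fin.<? j ⟧ * (⟦ j Fin.<? m ⟧ * ⟦ j Fin.<? l ⟧))
      ≡ ⟦ 0 ℕ.≤? toℕ i ⟧ * pyramid 3 (n ∸ suc (toℕ i))
  ∑-i i = trans (trans
    (∑-comm {n} {n} λ m j → ∑[ l < n ] (⟦ i Fin.<? j ⟧ * (⟦ j Fin.<? m ⟧ * ⟦ j Fin.<? l ⟧)))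
    (trans (sum-cong-≗ {n} (∑-ij i))
      (∑-telescope {pyramid 2} {pyramid 3} refl (pyramid-suc 2) n (suc (toℕ i)))))
    (sym (ℕ.*-identityˡ _))

theorem3p6 : (n : ℕ) → 3 ≤ n →
    f p123 n ≡ (n + 1) C 4 ×
    f p312 n ≡ (n + 1) C 4 ×
    (+ f p321 n) / 1 ≡ (+ (n * (n ∸ 2) * (n ∸ 1) ^ 2)) / 12
theorem3p6 n@(suc (suc t)) (s≤s (s≤s _)) = trans (f-123 n) (cong (_C 4) (ℕ.+-comm 1 n)) ,
  trans (f-312 n) (cong (_C 4) (ℕ.+-comm 1 n)) ,
  -- Equality of the fractions is checked by cross-multiplication. `mkℚᵘ` stores the denominator
  -- less one, so 0 and 11 stand for 1 and 12.
  fromℚᵘ-cong {mkℚᵘ (+ f p321 n) 0} {mkℚᵘ (+ (n * t * suc t ^ 2)) 11} (*≡* (begin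
    + f p321 n ℤ.* + 12             ≡⟨ ℤ.pos-* (f p321 n) 12 ⟨
    + (f p321 n * 12)               ≡⟨ cong (λ x → + (x * 12)) (f-321 n) ⟩
    + (pyramid 4 n * 12)            ≡⟨ cong (λ x → + x) (ℕ.*-comm (pyramid 4 n) 12) ⟩
    + (12 * pyramid 4 n)            ≡⟨ cong (λ x → + x) (pyramid-4 t) ⟩
    + (n * t * (suc t * suc t))     ≡⟨ cong (λ x → + (n * t * (suc t * x))) (ℕ.*-identityʳ (suc t)) ⟨
    + (n * t * suc t ^ 2)           ≡⟨ ℤ.*-identityʳ _ ⟨
    + (n * t * suc t ^ 2) ℤ.* + 1   ∎))
  where open ≡-Reasoning
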